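{- Let $S\subseteq\{0,1\}^n$ be the vertex set of an acute $0/1$-simplex in $[0,1]^n$ with $k$ vertices. If $\hat S$ is the vertex set of an acute $0/1$-simplex in $[0,1]^n$ having $\mathrm{conv}(S)$ as a facet (face), then each vertex of $\hat S$ belongs to $S$ or to $\mathcal{A}^n(S)$.
   Context: A set of $j+1$ affinely independent points $a_0,\dots,a_j\in\{0,1\}^n$ is the vertex set of an acute $0/1$-$j$-simplex if all dihedral angles of their convex hull are acute; equivalently, with $P=[a_1-a_0,\dots,a_j-a_0]$ and $G=P^\top P$, every off-diagonal entry of $G^{ -1}$ is negative and every row sum of $G^{ -1}$ is positive. For the vertex set $S$ of an acute $0/1$-simplex, $\mathcal{A}^n(S)$ is the set of all $v\in\{0,1\}^n$ such that $S\cup\{v\}$ is the vertex set of an acute $0/1$-simplex with one more vertex. Here a facet of a simplex means the convex hull of any nonempty subset of its vertices (a face of any dimension). -}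

module Defs where

open import Algebra.Bundles using (CommutativeRing)
open import Data.Bool.Base using (Bool; if_then_else_)
open import Data.Fin.Base using (Fin)
open import Data.Nat.Base as ℕ using (ℕ; suc)
open import Data.Product.Base using (∃; ∃₂; _×_)
open import Data.Rational.Base using (ℚ; 0ℚ; 1ℚ; _*_; _≤_; _<_)
open import Data.Rational.Properties using (+-*-commutativeRing)
open import Data.Vec.Base using (Vec; lookup)
open import Data.Vec.Functional using (Vector)
open import Function.Bundles using (_⇔_)
open import Level using (0ℓ) renaming (suc to lsuc)
open import Relation.Binary.PropositionalEquality using (_≡_; _≢_)
open import Relation.Unary using (Pred; _∈_; _⊆_; _∪_; _≐_; ｛_｝; Satisfiable)
open import Algebra.Properties.Semiring.Sum
  (CommutativeRing.semiring +-*-commutativeRing) public using (sum)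

-- The scalars are ℚ rather than ℝ. The points are rational, so affine
-- (in)dependence, the facet normals (up to positive scaling), and equality of
-- hulls of cube vertices are the same over either field.

Point : ℕ → Set
Point n = Vector ℚ n

-- The elements of {0,1}ⁿ; ⟦_⟧ embeds them in ℚⁿ.
Vertex : ℕ → Set
Vertex n = Vec Bool n

⟦_⟧ : ∀ {n} → Vertex n → Point n
⟦ v ⟧ x = if lookup v x then 1ℚ else 0ℚ

infix 7 _·_
_·_ : ∀ {n} → Point n → Point n → ℚ
p · q = sum λ x → p x * q x

combination : ∀ {n k} → Vector ℚ k → Vector (Vertex n) k → Point n
combination c a x = sum λ i → c i * ⟦ a i ⟧ x

AffinelyIndependent : ∀ {n k} → Vector (Vertex n) k → Set
AffinelyIndependent a =
  ∀ c → sum c ≡ 0ℚ → (∀ x → combination c a x ≡ 0ℚ) → ∀ i → c i ≡ 0ℚ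

-- q is an inward normal, within the affine hull of the simplex with vertices a,
-- to the facet Fᵢ spanned by the vertices other than a i. The vectors parallel
-- to the affine hull are the combinations with coefficient sum 0.
record InwardNormal {n k} (a : Vector (Vertex n) k) (i : Fin k) (q : Point n) : Set where
  field
    parallel : ∃ λ c → sum c ≡ 0ℚ × (∀ x → q x ≡ combination c a x)
    normal   : ∀ j m → j ≢ i → m ≢ i → q · ⟦ a j ⟧ ≡ q · ⟦ a m ⟧
    inward   : ∀ j → j ≢ i → q · ⟦ a j ⟧ < q · ⟦ a i ⟧

-- The dihedral angle between the facets Fᵢ and Fⱼ (i ≢ j) is the supplement of
-- the angle between their inward normals p and q: its cosine is
-- − (p · q) / (|p| |q|), so it is acute exactly when p · q < 0. For affinely
-- independent a, the normals exist and are unique up to a positive factor.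
AcuteDihedralAngle : ∀ {n k} → Vector (Vertex n) k → Fin k → Fin k → Set
AcuteDihedralAngle a i j =
  ∃₂ λ p q → InwardNormal a i p × InwardNormal a j q × p · q < 0ℚ

-- S is the vertex set of an acute 0/1-simplex with exactly k vertices.
record AcuteSimplex {n} (k : ℕ) (S : Pred (Vertex n) 0ℓ) : Set where
  field
    vertex              : Vector (Vertex n) k
    nonempty            : 1 ℕ.≤ k
    vertices            : ∀ v → v ∈ S ⇔ ∃ λ i → v ≡ vertex i
    affinelyIndependent : AffinelyIndependent vertex
    acute               : ∀ i j → i ≢ j → AcuteDihedralAngle vertex i j

𝒜 : ∀ {n} → Pred (Vertex n) 0ℓ → Pred (Vertex n) 0ℓ
𝒜 S v = ∃ λ k → AcuteSimplex k S × AcuteSimplex (suc k) (S ∪ ｛ v ｝)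

conv : ∀ {n} → Pred (Vertex n) 0ℓ → Pred (Point n) 0ℓ
conv {n} S p = ∃ λ k → ∃₂ λ (c : Vector ℚ k) (a : Vector (Vertex n) k) →
  (∀ i → a i ∈ S) × (∀ i → 0ℚ ≤ c i) × sum c ≡ 1ℚ × (∀ x → p x ≡ combination c a x)

-- F is a face, of any dimension, of the simplex with vertex set S.
_IsFaceOf_ : ∀ {n} → Pred (Point n) 0ℓ → Pred (Vertex n) 0ℓ → Set (lsuc 0ℓ)
F IsFaceOf S = ∃ λ T → Satisfiable T × T ⊆ S × F ≐ conv T

{-# OPTIONS --safe #-}
-- Let a be an acute simplex and v = Σ cₘ aₘ with Σ cₘ = 0. Pairing v with an
-- inward normal u at a vertex i gives v · u = cᵢ h, where h > 0 is the height of
-- aᵢ over the opposite facet in the direction u. So acuteness of the dihedral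
-- angles is negativity of coefficients of normals. When a vertex r with normal w
-- is removed, a normal p at another vertex is replaced by wᵣ p − pᵣ w (the
-- subscript denoting the coefficient at r), which no longer involves r, and the
-- inner products of the new normals are again negative. Hence every face of an
-- acute simplex is acute. Finally, S ⊆ Ŝ because a cube vertex that is a convex
-- combination of cube vertices is one of them.
module Submission where

open import Defs
open import Data.Nat.Base using (ℕ)
open import Level using (0ℓ)
open import Relation.Unary using (Pred; _⊆_; _∪_)

open import Algebra.Bundles using (CommutativeRing)
import Data.Bool.Properties as Bool
open import Data.Bool.Base using (true; false; if_then_else_)
open import Data.Fin.Base using (Fin; zero; suc; punchIn; punchOut)
open import Data.Fin.Permutation using (Permutation; permutation; _⟨$⟩ʳ_; _⟨$⟩ˡ_; inverseˡ)
open import Data.Fin.Properties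
  using (any?; all?; punchInᵢ≢i; punchIn-injective; punchIn-punchOut; ¬∀⟶∃¬)
  renaming (_≟_ to _≟ᶠ_)
open import Data.Nat.Base using (zero; suc; z≤n; s≤s)
open import Data.Product.Base using (∃; _×_; _,_; proj₁; proj₂)
open import Data.Rational.Base
  using (ℚ; 0ℚ; 1ℚ; _+_; _*_; -_; _-_; _≤_; _<_; positive; nonNegative)
open import Data.Rational.Properties
open import Algebra.Properties.Semiring.Sum
  (CommutativeRing.semiring +-*-commutativeRing)
  using (sum-cong-≗; sum-remove; ∑-distrib-+; ∑-comm; *-distribˡ-sum;
         *-distribʳ-sum; sum-permute; sum-replicate-zero)
open import Data.Rational.Solver using (module +-*-Solver)
open import Data.Sum.Base using (inj₁; inj₂)
open import Data.Vec.Base using (lookup)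
open import Data.Vec.Functional using (Vector; _∷_; insertAt)
open import Data.Vec.Functional.Properties using (insertAt-lookup; insertAt-punchIn)
open import Data.Vec.Properties using (≡-dec; tabulate∘lookup; tabulate-cong)
open import Function.Base using (_∘_)
open import Function.Bundles using (Equivalence; mk⇔)
open import Function.Definitions using (Injective)
open import Relation.Binary.PropositionalEquality
open import Relation.Nullary using (yes; no; contradiction)
open +-*-Solver using (solve; _:=_; _:+_; _:*_; _:-_; :-_; con)

-- Finite sums and inner products over the rationals.

sum-linear : ∀ {k} (α β : ℚ) (f g : Vector ℚ k) →
  sum (λ i → α * f i + β * g i) ≡ α * sum f + β * sum g
sum-linear α β f g = trans (∑-distrib-+ (λ i → α * f i) (λ i → β * g i))
  (sym (cong₂ _+_ (*-distribˡ-sum α f) (*-distribˡ-sum β g)))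

sum-linear-* : ∀ {k} (α β : ℚ) (f g h : Vector ℚ k) →
  sum (λ i → (α * f i + β * g i) * h i) ≡
  α * sum (λ i → f i * h i) + β * sum (λ i → g i * h i)
sum-linear-* α β f g h = trans
  (sum-cong-≗ λ i → solve 5 (λ α β f g h →
    (α :* f :+ β :* g) :* h := α :* (f :* h) :+ β :* (g :* h)) refl α β (f i) (g i) (h i))
  (sum-linear α β (λ i → f i * h i) (λ i → g i * h i))

sum-drop : ∀ {k} (r : Fin (suc k)) (f : Vector ℚ (suc k)) → f r ≡ 0ℚ →
  sum f ≡ sum (f ∘ punchIn r)
sum-drop r f fr≡0 = trans (sum-remove {i = r} f)
  (trans (cong (_+ sum (f ∘ punchIn r)) fr≡0) (+-identityˡ _))

sum-mono-≤ : ∀ {k} {f g : Vector ℚ k} → (∀ i → f i ≤ g i) → sum f ≤ sum g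
sum-mono-≤ {zero}  f≤g = ≤-refl
sum-mono-≤ {suc k} f≤g = +-mono-≤ (f≤g zero) (sum-mono-≤ (f≤g ∘ suc))

sum-mono-< : ∀ {k} {f g : Vector ℚ k} → (∀ i → f i ≤ g i) →
  ∀ i → f i < g i → sum f < sum g
sum-mono-< f≤g zero    fi<gi = +-mono-<-≤ fi<gi (sum-mono-≤ (f≤g ∘ suc))
sum-mono-< f≤g (suc i) fi<gi = +-mono-≤-< (f≤g zero) (sum-mono-< (f≤g ∘ suc) i fi<gi)

·-comm : ∀ {n} (p q : Point n) → p · q ≡ q · p
·-comm p q = sum-cong-≗ λ x → *-comm (p x) (q x)

·-congˡ : ∀ {n} {p q : Point n} (u : Point n) → p ≗ q → p · u ≡ q · u
·-congˡ u p≗q = sum-cong-≗ λ x → cong (_* u x) (p≗q x)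

·-combination : ∀ {n k} (a : Vector (Vertex n) k) (c : Vector ℚ k) (u : Point n) →
  combination c a · u ≡ sum (λ m → c m * (u · ⟦ a m ⟧))
·-combination a c u = begin
  sum (λ x → combination c a x * u x)
    ≡⟨ sum-cong-≗ (λ x → *-distribʳ-sum (u x) (λ m → c m * ⟦ a m ⟧ x)) ⟩
  sum (λ x → sum λ m → c m * ⟦ a m ⟧ x * u x)
    ≡⟨ ∑-comm (λ x m → c m * ⟦ a m ⟧ x * u x) ⟩
  sum (λ m → sum λ x → c m * ⟦ a m ⟧ x * u x)
    ≡⟨ sum-cong-≗ (λ m → sum-cong-≗ λ x → trans (*-assoc (c m) (⟦ a m ⟧ x) (u x))
         (cong (c m *_) (*-comm (⟦ a m ⟧ x) (u x)))) ⟩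
  sum (λ m → sum λ x → c m * (u x * ⟦ a m ⟧ x))
    ≡⟨ sum-cong-≗ (λ m → sym (*-distribˡ-sum (c m) (λ x → u x * ⟦ a m ⟧ x))) ⟩
  sum (λ m → c m * (u · ⟦ a m ⟧)) ∎
  where open ≡-Reasoning

-- Acute families of vertices.

Acute : ∀ {n k} → Vector (Vertex n) k → Set
Acute a = AffinelyIndependent a × (∀ i j → i ≢ j → AcuteDihedralAngle a i j)

-- An inward normal at `i` takes a strictly smaller value at every vertex with another index.
acute⇒injective : ∀ {n k} (a : Vector (Vertex n) k) → Acute a → Injective _≡_ _≡_ a
acute⇒injective a (_ , ac) {i} {j} ai≡aj with i ≟ᶠ j
... | yes i≡j = i≡j
... | no  i≢j =
  let p , _ , N , _ = ac i j i≢j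
  in contradiction (InwardNormal.inward N j (i≢j ∘ sym)) (<-irrefl (cong (λ v → p · ⟦ v ⟧) (sym ai≡aj)))

0<y-x : ∀ {x y} → x < y → 0ℚ < y - x
0<y-x {x} {y} x<y = subst (_< y - x) (+-inverseʳ x) (+-monoˡ-< (- x) x<y)

-- Inward normals and the signs of their coefficients.

open InwardNormal

-- Away from `i` the normal `u` has a constant value `H` on the vertices. As the coefficients sum to
-- 0, `H` may be subtracted from every value, which leaves only the term at `i`.
·-normal : ∀ {n k} {a : Vector (Vertex n) k} {i j u v c} → InwardNormal a i u → j ≢ i →
  sum c ≡ 0ℚ → v ≗ combination c a → v · u ≡ c i * (u · ⟦ a i ⟧ - u · ⟦ a j ⟧)
·-normal {k = suc k} {a} {i} {j} {u} {v} {c} N j≢i ∑c≡0 v≗ = begin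
  v · u                                ≡⟨ ·-congˡ u v≗ ⟩
  combination c a · u                  ≡⟨ ·-combination a c u ⟩
  sum (λ m → c m * (u · ⟦ a m ⟧))      ≡⟨ sum-remove {i = i} (λ m → c m * (u · ⟦ a m ⟧)) ⟩
  c i * U + sum (λ m → rest m * (u · ⟦ a (punchIn i m) ⟧))
    ≡⟨ cong (c i * U +_) (sum-cong-≗ λ m →
         cong (rest m *_) (normal N (punchIn i m) j (punchInᵢ≢i i m) j≢i)) ⟩
  c i * U + sum (λ m → rest m * H)     ≡⟨ cong (c i * U +_) (*-distribʳ-sum H rest) ⟨
  c i * U + sum rest * H               ≡⟨ solve 4 (λ c r U H →
                                            c :* U :+ r :* H := (c :+ r) :* H :+ c :* (U :- H))
                                            refl (c i) (sum rest) U H ⟩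
  (c i + sum rest) * H + c i * (U - H) ≡⟨ cong (λ z → z * H + c i * (U - H))
                                            (trans (sym (sum-remove {i = i} c)) ∑c≡0) ⟩
  0ℚ * H + c i * (U - H)               ≡⟨ cong (_+ c i * (U - H)) (*-zeroˡ H) ⟩
  0ℚ + c i * (U - H)                   ≡⟨ +-identityˡ _ ⟩
  c i * (U - H) ∎
  where
  open ≡-Reasoning
  U = u · ⟦ a i ⟧
  H = u · ⟦ a j ⟧
  rest = c ∘ punchIn i

module _ {n k} {a : Vector (Vertex n) k} where

  coefficient : ∀ {i q} → InwardNormal a i q → Vector ℚ k
  coefficient N = proj₁ (parallel N)

  obtuse⇒coefficient<0 : ∀ {i j p q} → i ≢ j →
    (P : InwardNormal a i p) → InwardNormal a j q → p · q < 0ℚ → coefficient P j < 0ℚ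
  obtuse⇒coefficient<0 {i} {j} {p} {q} i≢j P Q pq<0 =
    let c , ∑c≡0 , p≗ = parallel P
        h = q · ⟦ a j ⟧ - q · ⟦ a i ⟧
        h>0 = 0<y-x (inward Q i i≢j)
    in *-cancelʳ-<-nonNeg h {{nonNegative (<⇒≤ h>0)}}
         (subst₂ _<_ (·-normal Q i≢j ∑c≡0 p≗) (sym (*-zeroˡ h)) pq<0)

  coefficient<0⇒obtuse : ∀ {i j p q} → i ≢ j →
    (P : InwardNormal a i p) → InwardNormal a j q → coefficient P j < 0ℚ → p · q < 0ℚ
  coefficient<0⇒obtuse {i} {j} {p} {q} i≢j P Q cj<0 =
    let c , ∑c≡0 , p≗ = parallel P
        h = q · ⟦ a j ⟧ - q · ⟦ a i ⟧
        h>0 = 0<y-x (inward Q i i≢j)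
    in subst₂ _<_ (sym (·-normal Q i≢j ∑c≡0 p≗)) (*-zeroˡ h)
         (*-monoˡ-<-pos h {{positive h>0}} cj<0)

  -- The sign of p · q depends only on the coefficient of p at j, hence not on
  -- the choice of q; by symmetry it does not depend on p either.
  acute⇒normals-obtuse : ∀ {i j p q} → i ≢ j → AcuteDihedralAngle a i j →
    InwardNormal a i p → InwardNormal a j q → p · q < 0ℚ
  acute⇒normals-obtuse {i} {j} {p} {q} i≢j (p₀ , q₀ , P₀ , Q₀ , p₀q₀<0) P Q =
    subst (_< 0ℚ) (·-comm q p) (transfer (i≢j ∘ sym) Q P₀ P
      (subst (_< 0ℚ) (·-comm p₀ q) (transfer i≢j P₀ Q₀ Q p₀q₀<0)))
    where
    transfer : ∀ {i j p q q'} → i ≢ j → InwardNormal a i p →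
      InwardNormal a j q → InwardNormal a j q' → p · q < 0ℚ → p · q' < 0ℚ
    transfer i≢j P Q Q' pq<0 = coefficient<0⇒obtuse i≢j P Q' (obtuse⇒coefficient<0 i≢j P Q pq<0)

  acute⇒coefficient<0 : ∀ {i j p} → i ≢ j → AcuteDihedralAngle a i j →
    (P : InwardNormal a i p) → coefficient P j < 0ℚ
  acute⇒coefficient<0 i≢j ac@(_ , _ , _ , Q , _) P =
    obtuse⇒coefficient<0 i≢j P Q (acute⇒normals-obtuse i≢j ac P Q)

-- Removing one vertex of an acute simplex.

module _ {n k} {a : Vector (Vertex n) (suc k)} (acute : Acute a) (r : Fin (suc k)) where

  private
    a' : Vector (Vertex n) k
    a' = a ∘ punchIn r

    r≢ : ∀ i → r ≢ punchIn r i
    r≢ i = punchInᵢ≢i r i ∘ sym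

  -- The coefficients sum to 0 and all those away from `r` are negative. The argument of type
  -- `Fin k` provides at least one of these, so their sum is strictly negative.
  coefficient-self>0 : ∀ {w} → Fin k → (W : InwardNormal a r w) → 0ℚ < coefficient W r
  coefficient-self>0 i W = +-cancelʳ-<0 (subst (_≡ 0ℚ) (sum-remove {i = r} c) ∑c≡0) rest<0
    where
    c = coefficient W
    ∑c≡0 = proj₁ (proj₂ (parallel W))

    c<0 : ∀ m → c (punchIn r m) < 0ℚ
    c<0 m = acute⇒coefficient<0 (r≢ m) (proj₂ acute r (punchIn r m) (r≢ m)) W

    rest<0 : sum (c ∘ punchIn r) < 0ℚ
    rest<0 = subst (sum (c ∘ punchIn r) <_) (sum-replicate-zero k)
      (sum-mono-< (<⇒≤ ∘ c<0) i (c<0 i))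

    +-cancelʳ-<0 : ∀ {x y} → x + y ≡ 0ℚ → y < 0ℚ → 0ℚ < x
    +-cancelʳ-<0 {x} {y} x+y≡0 y<0 = subst₂ _<_ x+y≡0 (+-identityʳ x) (+-monoʳ-< x y<0)

  module _ {w} (W : InwardNormal a r w) where

    -- Up to the positive factor `coefficient W r`, this is the orthogonal projection of `p` along
    -- `w`, that is, onto the directions of the facet opposite `r`. The scaling avoids a division.
    eliminate : ∀ {i p} → InwardNormal a (punchIn r i) p → Point n
    eliminate {p = p} P x = coefficient W r * p x + - coefficient P r * w x

    eliminate-parallel : ∀ {i p} (P : InwardNormal a (punchIn r i) p) →
      ∃ λ c → sum c ≡ 0ℚ × c r ≡ 0ℚ × eliminate P ≗ combination c a
    eliminate-parallel {p = p} P =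
      let c , ∑c≡0 , p≗ = parallel P
          d , ∑d≡0 , w≗ = parallel W
          α = d r
          β = - c r
      in (λ m → α * c m + β * d m)
       , trans (sum-linear α β c d) (trans (cong₂ (λ s t → α * s + β * t) ∑c≡0 ∑d≡0)
           (trans (cong₂ _+_ (*-zeroʳ α) (*-zeroʳ β)) refl))
       , solve 2 (λ c d → d :* c :+ (:- c) :* d := con 0ℚ) refl (c r) (d r)
       , λ x → trans (cong₂ (λ s t → α * s + β * t) (p≗ x) (w≗ x))
                 (sym (sum-linear-* α β c d (λ m → ⟦ a m ⟧ x)))

    eliminate-· : ∀ {i p} (P : InwardNormal a (punchIn r i) p) (v : Point n) →
      eliminate P · v ≡ coefficient W r * (p · v) + - coefficient P r * (w · v)
    eliminate-· {p = p} P = sum-linear-* (coefficient W r) (- coefficient P r) p w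

    -- Since `w` is constant on the remaining vertices, the values of `eliminate P` there are those
    -- of `p`, scaled by a positive factor and shifted by a constant. Equalities and strict
    -- inequalities between values of `p` therefore carry over.
    eliminate-normal : ∀ {i p} (P : InwardNormal a (punchIn r i) p) →
      InwardNormal a' i (eliminate P)
    eliminate-normal {i} {p} P = record
      { parallel =
          let c , ∑c≡0 , cr≡0 , p'≗ = eliminate-parallel P
          in c ∘ punchIn r
           , trans (sym (sum-drop r c cr≡0)) ∑c≡0
           , λ x → trans (p'≗ x) (sum-drop r (λ m → c m * ⟦ a m ⟧ x)
               (trans (cong (_* ⟦ a r ⟧ x) cr≡0) (*-zeroˡ (⟦ a r ⟧ x))))
      ; normal = λ j m j≢i m≢i →
          trans (eliminate-· P ⟦ a' j ⟧)
            (trans (cong₂ (λ s t → α * s + β * t)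
                     (normal P (punchIn r j) (punchIn r m) (inj j≢i) (inj m≢i)) (flat j m))
              (sym (eliminate-· P ⟦ a' m ⟧)))
      ; inward = λ j j≢i →
          subst₂ _<_ (sym (eliminate-· P ⟦ a' j ⟧)) (sym (eliminate-· P ⟦ a' i ⟧))
            (subst (λ t → α * (p · ⟦ a' j ⟧) + β * t < α * (p · ⟦ a' i ⟧) + β * (w · ⟦ a' i ⟧))
              (flat i j)
              (+-monoˡ-< (β * (w · ⟦ a' i ⟧))
                (*-monoʳ-<-pos α {{positive (coefficient-self>0 i W)}}
                  (inward P (punchIn r j) (inj j≢i)))))
      }
      where
      α = coefficient W r
      β = - coefficient P r

      inj : ∀ {j m} → j ≢ m → punchIn r j ≢ punchIn r m
      inj j≢m = j≢m ∘ punchIn-injective r _ _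

      flat : ∀ j m → w · ⟦ a' j ⟧ ≡ w · ⟦ a' m ⟧
      flat j m = normal W (punchIn r j) (punchIn r m) (punchInᵢ≢i r j) (punchInᵢ≢i r m)

    -- By `·-normal`, the product with `w` is a multiple of the coefficient at `r`, which has been
    -- cancelled.
    eliminate-⊥ : ∀ {i p} (P : InwardNormal a (punchIn r i) p) → eliminate P · w ≡ 0ℚ
    eliminate-⊥ {i} P =
      let c , ∑c≡0 , cr≡0 , p'≗ = eliminate-parallel P
          h = w · ⟦ a r ⟧ - w · ⟦ a' i ⟧
      in trans (·-normal {c = c} W (punchInᵢ≢i r i) ∑c≡0 p'≗)
           (trans (cong (_* h) cr≡0) (*-zeroˡ h))

    -- Expanding `q'` leaves only `α * (q · p')`, because `p'` is orthogonal to `w`. Expanding `p'`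
    -- in `q · p'` then gives a combination of `p · q` and `w · q`, both negative, with positive
    -- weights `α` and `γ`.
    eliminate-obtuse : ∀ {i j p q} → i ≢ j → (P : InwardNormal a (punchIn r i) p)
      (Q : InwardNormal a (punchIn r j) q) → eliminate P · eliminate Q < 0ℚ
    eliminate-obtuse {i} {j} {p} {q} i≢j P Q = begin-strict
      p' · q'                       ≡⟨ ·-comm p' q' ⟩
      q' · p'                       ≡⟨ eliminate-· Q p' ⟩
      α * (q · p') + β * (w · p')   ≡⟨ cong (λ t → α * (q · p') + β * t) (trans (·-comm w p') (eliminate-⊥ P)) ⟩
      α * (q · p') + β * 0ℚ         ≡⟨ cong (α * (q · p') +_) (*-zeroʳ β) ⟩
      α * (q · p') + 0ℚ             ≡⟨ +-identityʳ _ ⟩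
      α * (q · p')                  <⟨ *-monoʳ-<-pos α {{positive α>0}} qp'<0 ⟩
      α * 0ℚ                        ≡⟨ *-zeroʳ α ⟩
      0ℚ ∎
      where
      open ≤-Reasoning
      p' = eliminate P
      q' = eliminate Q
      α = coefficient W r
      β = - coefficient Q r
      γ = - coefficient P r
      α>0 = coefficient-self>0 i W

      i'≢j' : punchIn r i ≢ punchIn r j
      i'≢j' = i≢j ∘ punchIn-injective r i j

      γ>0 : 0ℚ < γ
      γ>0 = neg-antimono-< (acute⇒coefficient<0 (punchInᵢ≢i r i)
        (proj₂ acute (punchIn r i) r (punchInᵢ≢i r i)) P)

      pq<0 : p · q < 0ℚ
      pq<0 = acute⇒normals-obtuse i'≢j' (proj₂ acute (punchIn r i) (punchIn r j) i'≢j') P Q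

      wq<0 : w · q < 0ℚ
      wq<0 = acute⇒normals-obtuse (r≢ j) (proj₂ acute r (punchIn r j) (r≢ j)) W Q

      qp'<0 : q · p' < 0ℚ
      qp'<0 = begin-strict
        q · p'                     ≡⟨ ·-comm q p' ⟩
        p' · q                     ≡⟨ eliminate-· P q ⟩
        α * (p · q) + γ * (w · q)  <⟨ +-mono-< (*-monoʳ-<-pos α {{positive α>0}} pq<0)
                                               (*-monoʳ-<-pos γ {{positive γ>0}} wq<0) ⟩
        α * 0ℚ + γ * 0ℚ            ≡⟨ cong₂ _+_ (*-zeroʳ α) (*-zeroʳ γ) ⟩
        0ℚ ∎

  acute-remove : Acute a'
  acute-remove = independent , angle
    where
    independent : AffinelyIndependent a'
    independent c ∑c≡0 comb≡0 i =
      trans (sym (insertAt-punchIn c r 0ℚ i)) (proj₁ acute c⁺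
        (trans (sum-drop r c⁺ c⁺r≡0) (trans (sum-cong-≗ (insertAt-punchIn c r 0ℚ)) ∑c≡0))
        (λ x → trans (sum-drop r (λ m → c⁺ m * ⟦ a m ⟧ x)
                        (trans (cong (_* ⟦ a r ⟧ x) c⁺r≡0) (*-zeroˡ (⟦ a r ⟧ x))))
                 (trans (sum-cong-≗ λ m → cong (_* ⟦ a' m ⟧ x) (insertAt-punchIn c r 0ℚ m))
                   (comb≡0 x)))
        (punchIn r i))
      where
      -- A dependence among the remaining vertices extends to the whole family with coefficient 0 at
      -- `r`.
      c⁺ = insertAt c r 0ℚ
      c⁺r≡0 = insertAt-lookup c r 0ℚ

    angle : ∀ i j → i ≢ j → AcuteDihedralAngle a' i j
    angle i j i≢j =
      let i'≢j' = i≢j ∘ punchIn-injective r i j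
          p , q , P , Q , _ = proj₂ acute (punchIn r i) (punchIn r j) i'≢j'
          -- Normals come only with dihedral angles, so one at `r` is taken from the angle between
          -- `punchIn r i` and `r`.
          _ , _ , _ , W , _ = proj₂ acute (punchIn r i) r (punchInᵢ≢i r i)
      in eliminate W P , eliminate W Q , eliminate-normal W P , eliminate-normal W Q
       , eliminate-obtuse W i≢j P Q

-- Reindexing, and faces of acute simplices.

acute-permute : ∀ {n k l} {a : Vector (Vertex n) l} {b : Vector (Vertex n) k} (π : Permutation k l) →
  b ≗ a ∘ (π ⟨$⟩ʳ_) → Acute a → Acute b
acute-permute {n} {k} {l} {a} {b} π b≗ (independent , angle) = independent' , angle'
  where
  combination-permute : ∀ c x → combination c a x ≡ combination (c ∘ (π ⟨$⟩ʳ_)) b x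
  combination-permute c x = trans (sum-permute (λ m → c m * ⟦ a m ⟧ x) π)
    (sum-cong-≗ λ i → cong (λ v → c (π ⟨$⟩ʳ i) * ⟦ v ⟧ x) (sym (b≗ i)))

  independent' : AffinelyIndependent b
  independent' c ∑c≡0 comb≡0 i = trans (sym (back i))
    (independent c⁺ (trans (sum-permute c⁺ π) (trans (sum-cong-≗ back) ∑c≡0))
      (λ x → trans (combination-permute c⁺ x)
        (trans (sum-cong-≗ λ m → cong (_* ⟦ b m ⟧ x) (back m)) (comb≡0 x)))
      (π ⟨$⟩ʳ i))
    where
    c⁺ : Vector ℚ l
    c⁺ = c ∘ (π ⟨$⟩ˡ_)
    back : ∀ m → c⁺ (π ⟨$⟩ʳ m) ≡ c m
    back m = cong c (inverseˡ π)

  π-injective : ∀ {i j} → π ⟨$⟩ʳ i ≡ π ⟨$⟩ʳ j → i ≡ j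
  π-injective eq = trans (sym (inverseˡ π)) (trans (cong (π ⟨$⟩ˡ_) eq) (inverseˡ π))

  normal' : ∀ {i q} → InwardNormal a (π ⟨$⟩ʳ i) q → InwardNormal b i q
  normal' {i} {q} N = record
    { parallel =
        let c , ∑c≡0 , q≗ = parallel N
        in c ∘ (π ⟨$⟩ʳ_) , trans (sym (sum-permute c π)) ∑c≡0
         , λ x → trans (q≗ x) (combination-permute c x)
    ; normal = λ j m j≢i m≢i → trans (value j)
        (trans (normal N _ _ (j≢i ∘ π-injective) (m≢i ∘ π-injective)) (sym (value m)))
    ; inward = λ j j≢i → subst₂ _<_ (sym (value j)) (sym (value i)) (inward N _ (j≢i ∘ π-injective))
    }
    where
    value : ∀ j → q · ⟦ b j ⟧ ≡ q · ⟦ a (π ⟨$⟩ʳ j) ⟧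
    value j = cong (λ v → q · ⟦ v ⟧) (b≗ j)

  angle' : ∀ i j → i ≢ j → AcuteDihedralAngle b i j
  angle' i j i≢j =
    let p , q , P , Q , pq<0 = angle (π ⟨$⟩ʳ i) (π ⟨$⟩ʳ j) (i≢j ∘ π-injective)
    in p , q , normal' P , normal' Q , pq<0

-- Induction on `l`: an injection that is onto is a permutation. Otherwise some index `r` is missed,
-- and `f` factors through `punchIn r` into the family without that vertex.
acute-subfamily : ∀ {n k} l {a : Vector (Vertex n) l} {b : Vector (Vertex n) k} (f : Fin k → Fin l) →
  b ≗ a ∘ f → Injective _≡_ _≡_ f → Acute a → Acute b
acute-subfamily l f b≗ f-inj ac with all? (λ m → any? (λ i → f i ≟ᶠ m))
... | yes onto = acute-permute
        (permutation f (proj₁ ∘ onto) (proj₂ ∘ onto) (λ i → f-inj (proj₂ (onto (f i))))) b≗ ac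
acute-subfamily zero f b≗ f-inj ac | no ¬onto = contradiction (λ ()) ¬onto
acute-subfamily (suc l) {a} f b≗ f-inj ac | no ¬onto =
  acute-subfamily l f' (λ i → trans (b≗ i) (cong a (sym (in-f' i)))) f'-inj (acute-remove ac r)
  where
  missed = ¬∀⟶∃¬ _ _ (λ m → any? (λ i → f i ≟ᶠ m)) ¬onto
  r = proj₁ missed

  r≢f : ∀ i → r ≢ f i
  r≢f i r≡fi = proj₂ missed (i , sym r≡fi)

  f' = λ i → punchOut (r≢f i)

  in-f' : ∀ i → punchIn r (f' i) ≡ f i
  in-f' i = punchIn-punchOut (r≢f i)

  f'-inj : Injective _≡_ _≡_ f'
  f'-inj {i} {j} eq = f-inj (trans (sym (in-f' i)) (trans (cong (punchIn r) eq) (in-f' j)))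

-- Cube vertices as extreme points, and the inclusion of vertex sets.

0≤⟦⟧ : ∀ {n} (v : Vertex n) x → 0ℚ ≤ ⟦ v ⟧ x
0≤⟦⟧ v x with lookup v x
... | true  = <⇒≤ (positive⁻¹ 1ℚ)
... | false = ≤-refl

⟦⟧≤1 : ∀ {n} (v : Vertex n) x → ⟦ v ⟧ x ≤ 1ℚ
⟦⟧≤1 v x with lookup v x
... | true  = ≤-refl
... | false = <⇒≤ (positive⁻¹ 1ℚ)

0≤*⟦⟧ : ∀ {n c} (v : Vertex n) x → 0ℚ ≤ c → 0ℚ ≤ c * ⟦ v ⟧ x
0≤*⟦⟧ {c = c} v x 0≤c = subst (_≤ c * ⟦ v ⟧ x) (*-zeroʳ c)
  (*-monoˡ-≤-nonNeg c {{nonNegative 0≤c}} (0≤⟦⟧ v x))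

*⟦⟧≤ : ∀ {n c} (v : Vertex n) x → 0ℚ ≤ c → c * ⟦ v ⟧ x ≤ c
*⟦⟧≤ {c = c} v x 0≤c = subst (c * ⟦ v ⟧ x ≤_) (*-identityʳ c)
  (*-monoˡ-≤-nonNeg c {{nonNegative 0≤c}} (⟦⟧≤1 v x))

-- Any point of positive weight is the given vertex: a coordinate where they differ
-- makes the convex combination lie strictly between 0 and 1 there.
vertex-extreme : ∀ {n k} (v : Vertex n) (c : Vector ℚ k) (a : Vector (Vertex n) k) →
  (∀ i → 0ℚ ≤ c i) → sum c ≡ 1ℚ → ⟦ v ⟧ ≗ combination c a → ∃ λ i → a i ≡ v
vertex-extreme {k = k} v c a 0≤c ∑c≡1 v≗ with any? (λ i → 0ℚ <? c i)
-- With no positive weight, the total weight 1 would be at most 0.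
... | no none = contradiction (<-≤-trans (positive⁻¹ 1ℚ) 1≤0) (<-irrefl refl)
  where
  1≤0 : 1ℚ ≤ 0ℚ
  1≤0 = subst₂ _≤_ ∑c≡1 (sum-replicate-zero k) (sum-mono-≤ λ i → ≮⇒≥ λ 0<ci → none (i , 0<ci))
... | yes (i , 0<ci) = i , ext agree
  where
  ext : ∀ {u v : Vertex _} → lookup u ≗ lookup v → u ≡ v
  ext {u} {v} u≗v = trans (sym (tabulate∘lookup u)) (trans (tabulate-cong u≗v) (tabulate∘lookup v))

  agree : ∀ x → lookup (a i) x ≡ lookup v x
  agree x with lookup (a i) x in ai | lookup v x in vx
  ... | true  | true  = refl
  ... | false | false = refl
  ... | true  | false = contradiction 0<0 (<-irrefl refl)
    where
    0<term : 0ℚ < c i * ⟦ a i ⟧ x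
    0<term rewrite ai = subst (0ℚ <_) (sym (*-identityʳ (c i))) 0<ci
    0<0 : 0ℚ < 0ℚ
    0<0 = subst₂ _<_ (sum-replicate-zero k)
      (trans (sym (v≗ x)) (cong (λ t → if t then 1ℚ else 0ℚ) vx))
      (sum-mono-< (λ j → 0≤*⟦⟧ (a j) x (0≤c j)) i 0<term)
  ... | false | true  = contradiction 1<1 (<-irrefl refl)
    where
    term<c : c i * ⟦ a i ⟧ x < c i
    term<c rewrite ai = subst (_< c i) (sym (*-zeroʳ (c i))) 0<ci
    -- Compares the coordinate sum term by term with the weights, whose total is 1; the term at `i`
    -- is strictly smaller.
    1<1 : 1ℚ < 1ℚ
    1<1 = subst₂ _<_ (trans (sym (v≗ x)) (cong (λ t → if t then 1ℚ else 0ℚ) vx)) ∑c≡1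
      (sum-mono-< (λ j → *⟦⟧≤ (a j) x (0≤c j)) i term<c)

S⊆convS : ∀ {n} {S : Pred (Vertex n) 0ℓ} {v} → S v → conv S ⟦ v ⟧
S⊆convS {v = v} v∈S = 1 , (λ _ → 1ℚ) , (λ _ → v) , (λ _ → v∈S)
  , (λ _ → <⇒≤ (positive⁻¹ 1ℚ)) , refl
  , λ x → sym (trans (+-identityʳ _) (*-identityˡ (⟦ v ⟧ x)))

-- A vertex in `S` lies in the hull of `T`, so by extremality it is one of the points of `T` in the
-- convex combination.
face⇒⊆ : ∀ {n} {S Ŝ : Pred (Vertex n) 0ℓ} → conv S IsFaceOf Ŝ → S ⊆ Ŝ
face⇒⊆ {Ŝ = Ŝ} (T , _ , T⊆Ŝ , convS⊆convT , _) {v} v∈S =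
  let _ , c , a , a∈T , 0≤c , ∑c≡1 , v≗ = convS⊆convT {⟦ v ⟧} (S⊆convS {v = v} v∈S)
      i , ai≡v = vertex-extreme v c a 0≤c ∑c≡1 v≗
  in subst Ŝ ai≡v (T⊆Ŝ (a∈T i))

-- Adjoining a vertex of the larger simplex.

open AcuteSimplex
open Equivalence using (to; from)

acuteFamily : ∀ {n k} {S : Pred (Vertex n) 0ℓ} (A : AcuteSimplex k S) → Acute (vertex A)
acuteFamily A = affinelyIndependent A , acute A

-- The vertices of `A` together with `v` are distinct and all lie in `Ŝ`, so they form a subfamily
-- of the vertices of an acute simplex.
acute-insert : ∀ {n k l} {S Ŝ : Pred (Vertex n) 0ℓ} {v} (A : AcuteSimplex k S) → AcuteSimplex l Ŝ →
  S ⊆ Ŝ → Ŝ v → (∀ i → v ≢ vertex A i) → AcuteSimplex (suc k) (S ∪ (v ≡_))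
acute-insert {k = k} {l} {S} {Ŝ} {v} A Â S⊆Ŝ v∈Ŝ v∉A = record
  { vertex = b
  ; nonempty = s≤s z≤n
  ; vertices = λ u → mk⇔
      (λ { (inj₁ u∈S) → let i , eq = to (vertices A u) u∈S in suc i , eq
         ; (inj₂ refl) → zero , refl })
      (λ { (zero , refl) → inj₂ refl
         ; (suc i , eq) → inj₁ (from (vertices A u) (i , eq)) })
  ; affinelyIndependent = proj₁ b-acute
  ; acute = proj₂ b-acute
  }
  where
  b = v ∷ vertex A

  b-injective : Injective _≡_ _≡_ b
  b-injective {zero}  {zero}  _  = refl
  b-injective {zero}  {suc j} eq = contradiction eq (v∉A j)
  b-injective {suc i} {zero}  eq = contradiction (sym eq) (v∉A i)
  b-injective {suc i} {suc j} eq = cong suc (acute⇒injective (vertex A) (acuteFamily A) eq)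

  b∈Ŝ : ∀ i → Ŝ (b i)
  b∈Ŝ zero    = v∈Ŝ
  b∈Ŝ (suc i) = S⊆Ŝ (from (vertices A _) (i , refl))

  index : ∀ i → ∃ λ m → b i ≡ vertex Â m
  index i = to (vertices Â (b i)) (b∈Ŝ i)

  b-acute : Acute b
  -- Two positions with the same index in `Â` carry the same vertex, so they agree by injectivity of
  -- `b`.
  b-acute = acute-subfamily l (proj₁ ∘ index) (proj₂ ∘ index)
    (λ {i} {j} eq → b-injective (trans (proj₂ (index i))
      (trans (cong (vertex Â) eq) (sym (proj₂ (index j))))))
    (acuteFamily Â)

theorem5p12 : ∀ (n k l : ℕ) (S Ŝ : Pred (Vertex n) 0ℓ) →
    AcuteSimplex k S → AcuteSimplex l Ŝ →
    conv S IsFaceOf Ŝ → Ŝ ⊆ S ∪ 𝒜 S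
-- `S` is an arbitrary predicate; membership is decided by searching its finite enumeration.
theorem5p12 n k l S Ŝ A Â face {v} v∈Ŝ with any? (λ i → ≡-dec Bool._≟_ v (vertex A i))
... | yes v∈A = inj₁ (from (vertices A v) v∈A)
... | no  v∉A = inj₂ (k , A , acute-insert A Â (face⇒⊆ face) v∈Ŝ (λ i eq → v∉A (i , eq)))
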